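{- Let $s\geq 2$ be an even integer, let $m\geq 3$ be an integer, let $t\geq 1$ be an integer, and let $n$ be an integer with $n\geq \left(\frac{sm}{2}-1\right)(2sm-1)+1$. Then $$R(tP_n,J_{s,m})=tn+\frac{sm}{2}-1.$$
   Context: All graphs are finite and simple. For graphs $G$ and $H$, the Ramsey number $R(G,H)$ is the least natural number $N$ such that for every graph $F$ on $N$ vertices, either $F$ contains $G$ as a subgraph or the complement $\overline{F}$ contains $H$ as a subgraph. $P_n$ denotes the path on $n$ vertices, and $tP_n$ denotes the disjoint union of $t$ copies of $P_n$. For integers $s,m\geq 2$, the generalized Jahangir graph $J_{s,m}$ is the graph on $sm+1$ vertices consisting of a cycle $C_{sm}=v_1v_2\cdots v_{sm}v_1$ together with one additional vertex adjacent to exactly the $m$ cycle vertices $v_1, v_{s+1}, v_{2s+1},\ldots,v_{(m-1)s+1}$ (i.e., $m$ vertices of the cycle at distance $s$ from each other along the cycle). -}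

module Defs where

open import Data.Nat using (ℕ; suc; _*_; _≤_; _≟_)
open import Data.Fin using (Fin; zero; suc; toℕ; remQuot)
open import Data.Fin.Properties as Fin using (any?)
open import Data.Empty using (⊥)
open import Data.Product using (Σ; ∃-syntax; _×_; _,_; proj₁; proj₂)
open import Data.Sum using (_⊎_; swap)
open import Function.Definitions using (Injective)
open import Level using (0ℓ)
open import Relation.Binary.Core using (Rel)
open import Relation.Binary.Definitions using (Symmetric; Irreflexive; Decidable)
open import Relation.Binary.PropositionalEquality using (_≡_; _≢_; refl; sym)
open import Relation.Nullary using (¬_; no)
open import Relation.Nullary.Decidable using (¬?; _×-dec_; _⊎-dec_)

-- Decidability of adjacency makes these exactly the finite simple graphs of
-- classical mathematics.
record Graph (n : ℕ) : Set₁ where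
  field
    Adj    : Rel (Fin n) 0ℓ
    symm   : Symmetric Adj
    irrefl : Irreflexive _≡_ Adj
    adj?   : Decidable Adj

open Graph public

complement : ∀ {n} → Graph n → Graph n
complement G .Adj i j             = i ≢ j × ¬ Adj G i j
complement G .symm (i≢j , ¬a)     = (λ j≡i → i≢j (sym j≡i)) , (λ a → ¬a (symm G a))
complement G .irrefl i≡j (i≢j , _) = i≢j i≡j
complement G .adj? i j            = ¬? (i Fin.≟ j) ×-dec ¬? (adj? G i j)

-- F contains G as a (not necessarily induced) subgraph.
Contains : ∀ {N n} → Graph N → Graph n → Set
Contains {N} {n} F G =
  Σ (Fin n → Fin N) λ f →
    Injective _≡_ _≡_ f × (∀ {i j} → Adj G i j → Adj F (f i) (f j))

Arrows : ∀ {a b} → ℕ → Graph a → Graph b → Set₁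
Arrows N G H = (F : Graph N) → Contains F G ⊎ Contains (complement F) H

-- R(G,H) = N, as a relation, so that the existence of R(G,H) is part of the
-- assertion rather than a prerequisite for writing it.
IsRamseyNumber : ∀ {a b} → Graph a → Graph b → ℕ → Set₁
IsRamseyNumber G H N = Arrows N G H × (∀ M → Arrows M G H → N ≤ M)

-- The simple graph generated by a relation: symmetrise and drop loops.
fromRel : ∀ {n} (R : Rel (Fin n) 0ℓ) → Decidable R → Graph n
fromRel R R? .Adj i j              = i ≢ j × (R i j ⊎ R j i)
fromRel R R? .symm (i≢j , r)       = (λ j≡i → i≢j (sym j≡i)) , swap r
fromRel R R? .irrefl i≡j (i≢j , _) = i≢j i≡j
fromRel R R? .adj? i j             = ¬? (i Fin.≟ j) ×-dec (R? i j ⊎-dec R? j i)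

path : ∀ n → Graph n
path n = fromRel (λ i j → toℕ j ≡ suc (toℕ i)) (λ i j → toℕ j ≟ suc (toℕ i))

-- Disjoint union of t copies of G; remQuot splits a vertex into the index of
-- its copy and its position within that copy.
copies : ∀ t {n} → Graph n → Graph (t * n)
copies t {n} G = record
  { Adj    = λ x y → copy x ≡ copy y × Adj G (pos x) (pos y)
  ; symm   = λ (c , a) → sym c , symm G a
  ; irrefl = λ { refl (_ , a) → irrefl G refl a }
  ; adj?   = λ x y → (copy x Fin.≟ copy y) ×-dec adj? G (pos x) (pos y)
  }
  where
  copy : Fin (t * n) → Fin t
  copy x = proj₁ (remQuot {t} n x)

  pos : Fin (t * n) → Fin n
  pos x = proj₂ (remQuot {t} n x)

CyclicSuc : ∀ {k} → Rel (Fin k) 0ℓ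
CyclicSuc {k} i j = toℕ j ≡ suc (toℕ i) ⊎ (suc (toℕ i) ≡ k × toℕ j ≡ 0)

cyclicSuc? : ∀ {k} → Decidable (CyclicSuc {k})
cyclicSuc? {k} i j =
  (toℕ j ≟ suc (toℕ i)) ⊎-dec ((suc (toℕ i) ≟ k) ×-dec (toℕ j ≟ 0))

-- Vertex zero is the additional vertex (the hub), and suc i is the cycle vertex
-- v₍ᵢ₊₁₎, so the neighbours of the hub are the suc i with i = 0, s, …, (m-1)s.
-- Intended for s, m ≥ 2.
JahangirRel : ∀ s m → Rel (Fin (suc (s * m))) 0ℓ
JahangirRel s m zero    zero    = ⊥
JahangirRel s m zero    (suc i) = ∃[ q ] toℕ i ≡ toℕ {m} q * s
JahangirRel s m (suc i) zero    = ⊥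
JahangirRel s m (suc i) (suc j) = CyclicSuc i j

jahangirRel? : ∀ s m → Decidable (JahangirRel s m)
jahangirRel? s m zero    zero    = no λ ()
jahangirRel? s m zero    (suc i) = any? λ q → toℕ i ≟ toℕ q * s
jahangirRel? s m (suc i) zero    = no λ ()
jahangirRel? s m (suc i) (suc j) = cyclicSuc? i j

jahangir : ∀ s m → Graph (suc (s * m))
jahangir s m = fromRel (JahangirRel s m) (jahangirRel? s m)

{-# OPTIONS --safe #-}
module Submission where

-- Put k = sm/2.  Since s is even, J is bipartite with classes of sizes k and
-- k + 1 and contains a matching of size k.
--
-- Lower bound: take a clique on tn − 1 vertices and k − 1 isolated vertices.  The
-- isolated vertices cover all edges of the complement, which therefore has no
-- matching of size k.
--
-- Upper bound: removing paths one at a time reduces to t = 1, on at least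
-- n + k − 1 vertices.  Depth-first search yields either a K_{k,k+1} in the
-- complement, which contains J, or a path missing at most 2k vertices.  Let p be
-- a path with fewer than n vertices and w a vertex off p.  If the predecessors on
-- p of the neighbours of w, together with w, are not independent, then inserting
-- w or rotating gives a path on p ∪ {w}.  Otherwise w has at most 2k − 1
-- neighbours on p, or the complement has a clique on 2k + 1 vertices, which also
-- contains J.  In the former case k vertices off p have together at most k(2k − 1)
-- neighbours on p, so they form a K_{k,k+1} in the complement with k + 1 vertices
-- of the long path p.

open import Defs
open import Data.Nat using (ℕ; _+_; _*_; _∸_; _≥_; _/_)
open import Data.Nat.Divisibility using (_∣_)

open import Data.Nat
  using (zero; suc; _≤_; _<_; z≤n; s≤s; s≤s⁻¹; _≤?_; _<?_; parity; ⌊_/2⌋)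
open import Data.Nat.DivMod using (m*n/n≡m)
open import Data.Nat.Divisibility using (divides)
open import Data.Nat.Properties
open import Data.Nat.Tactic.RingSolver using (solve-∀)
open import Data.Parity.Base using (Parity; 0ℙ; 1ℙ; _⁻¹) renaming (_*_ to _*ℙ_)
import Data.Parity.Properties as ℙ
open import Data.Fin using (Fin; zero; suc; toℕ; fromℕ<; inject≤; inject₁; combine; remQuot)
import Data.Fin.Properties as Fin
open import Data.Product using (∃₂; ∃-syntax; _×_; _,_; proj₁; proj₂)
open import Data.Sum using (_⊎_; inj₁; inj₂)
open import Data.List
  using (List; []; _∷_; [_]; _++_; length; lookup; filter; reverse; take; drop)
open import Data.List.Properties
  using (++-assoc; unfold-reverse; length-++; filter-reject; take++drop≡id; length-take; length-tabulate)
open import Data.List.Membership.Propositional using (_∈_; find; lose)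
open import Data.List.Membership.Propositional.Properties
  using (∈-∃++; ∈-filter⁻; ∈-lookup; ∈-++⁺ˡ; ∈-++⁺ʳ)
open import Data.List.Relation.Unary.All as All using (All; []; _∷_)
open import Data.List.Relation.Unary.Any using (here; there; any?)
open import Data.List.Relation.Unary.AllPairs using (AllPairs; []; _∷_; zip)
open import Data.List.Relation.Unary.Unique.Propositional using (Unique)
open import Data.List.Relation.Unary.Unique.Propositional.Properties using (allFin⁺)
open import Data.List.Relation.Binary.Sublist.Propositional
  using (_⊆_; []; _∷_; _∷ʳ_; ⊆-refl; ⊆-trans; minimum; from∈)
open import Data.List.Relation.Binary.Sublist.Propositional.Properties
  using (All-resp-⊆; Any-resp-⊆; length-mono-≤; take-⊆; filter-⊆; filter⁺)
import Data.List.Relation.Binary.Sublist.Propositional.Properties as Sub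
open import Data.List.Relation.Binary.Permutation.Propositional
  using (_↭_; ↭-refl; ↭-sym; ↭-trans; ↭-reflexive; ↭⇒↭ₛ; prep)
open import Data.List.Relation.Binary.Permutation.Propositional.Properties
  using (shift; shifts; ++⁺ˡ; ++⁺ʳ; ↭-reverse; ↭-length; ∈-resp-↭; ++-comm)
import Data.List.Relation.Binary.Permutation.Setoid.Properties as PermS
open import Function.Definitions using (Injective)
open import Level using (0ℓ)
open import Relation.Binary.Core using (Rel)
open import Relation.Binary.Definitions using (Symmetric; Decidable)
open import Relation.Binary.PropositionalEquality
  using (_≡_; _≢_; refl; sym; trans; cong; cong₂; subst; setoid; ≢-sym; module ≡-Reasoning)
open import Relation.Nullary using (¬_; Dec; yes; no; contradiction)
open import Relation.Nullary.Decidable using (¬?; _×-dec_)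

-- Sublists, permutations and repetition-free lists.

AllPairs-resp-⊆ : {A : Set} {R : Rel A 0ℓ} {xs ys : List A} →
  xs ⊆ ys → AllPairs R ys → AllPairs R xs
AllPairs-resp-⊆ []         []       = []
AllPairs-resp-⊆ (_ ∷ʳ s)   (_ ∷ ps) = AllPairs-resp-⊆ s ps
AllPairs-resp-⊆ (refl ∷ s) (p ∷ ps) = All-resp-⊆ s p ∷ AllPairs-resp-⊆ s ps

all-or : {A B : Set} {P : A → Set} (xs : List A) →
  (∀ {x} → x ∈ xs → B ⊎ P x) → B ⊎ All P xs
all-or []       f = inj₂ []
all-or (x ∷ xs) f with f (here refl) | all-or xs (λ i → f (there i))
... | inj₁ b | _       = inj₁ b
... | inj₂ _ | inj₁ b  = inj₁ b
... | inj₂ p | inj₂ ps = inj₂ (p ∷ ps)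

∈⇒↭∷ : {A : Set} {x : A} {xs : List A} → x ∈ xs → ∃[ ys ] xs ↭ x ∷ ys
∈⇒↭∷ {x = x} i with ∈-∃++ i
... | ys , zs , refl = ys ++ zs , shift x ys zs

length-filter-¬ : {A : Set} {P : A → Set} (P? : ∀ x → Dec (P x)) (xs : List A) →
  length xs ≡ length (filter (λ x → ¬? (P? x)) xs) + length (filter P? xs)
length-filter-¬ P? [] = refl
length-filter-¬ P? (x ∷ xs) with P? x
... | yes _ = trans (cong suc (length-filter-¬ P? xs)) (sym (+-suc _ _))
... | no  _ = cong suc (length-filter-¬ P? xs)

Unique-resp-↭ : {A : Set} {xs ys : List A} → xs ↭ ys → Unique xs → Unique ys
Unique-resp-↭ p = PermS.Unique-resp-↭ (setoid _) (↭⇒↭ₛ p)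

length-take-≤ : {A : Set} {n : ℕ} (xs : List A) → n ≤ length xs → length (take n xs) ≡ n
length-take-≤ {n = n} xs n≤ = trans (length-take n xs) (m≤n⇒m⊓n≡m n≤)

AllPairs-lookup : {A : Set} {R : Rel A 0ℓ} → Symmetric R → ∀ {xs} → AllPairs R xs →
  ∀ i j → i ≢ j → R (lookup xs i) (lookup xs j)
AllPairs-lookup sy (p ∷ ps) zero    zero    i≢j = contradiction refl i≢j
AllPairs-lookup sy (p ∷ ps) zero    (suc j) i≢j = All.lookup p (∈-lookup j)
AllPairs-lookup sy (p ∷ ps) (suc i) zero    i≢j = sy (All.lookup p (∈-lookup i))
AllPairs-lookup sy (p ∷ ps) (suc i) (suc j) i≢j = AllPairs-lookup sy ps i j (λ e → i≢j (cong suc e))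

lookup-injective : {A : Set} {xs : List A} → Unique xs → ∀ i j → lookup xs i ≡ lookup xs j → i ≡ j
lookup-injective uniq i j eq with i Fin.≟ j
... | yes i≡j = i≡j
... | no  i≢j = contradiction eq (AllPairs-lookup ≢-sym uniq i j i≢j)

Unique-++⇒≢ : {A : Set} {x y : A} (xs : List A) {ys : List A} →
  Unique (xs ++ ys) → x ∈ xs → y ∈ ys → x ≢ y
Unique-++⇒≢ (_ ∷ xs) (p ∷ ps) (here refl) j = All.lookup p (∈-++⁺ʳ xs j)
Unique-++⇒≢ (_ ∷ xs) (p ∷ ps) (there i)   j = Unique-++⇒≢ xs ps i j

take-drop-++ : {A : Set} (n : ℕ) (xs : List A) {ys : List A} →
  xs ++ ys ≡ take n xs ++ (drop n xs ++ ys)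
take-drop-++ n xs {ys} =
  trans (cong (_++ ys) (sym (take++drop≡id n xs))) (++-assoc (take n xs) (drop n xs) ys)

-- Walks, and how an outside vertex is absorbed by insertion or rotation.

module Paths {V : Set} (E : Rel V 0ℓ) (E-sym : Symmetric E) (E? : Decidable E) where

  -- The list contains both ends. Repetitions are allowed here; that a walk is a path follows from
  -- `Unique` of the full vertex list, carried along permutations.
  data Walk : V → List V → V → Set where
    stop : ∀ {x} → Walk x [ x ] x
    step : ∀ {x y z p} → E x y → Walk y p z → Walk x (x ∷ p) z


  join : ∀ {a b c d p q} → Walk a p b → E b c → Walk c q d → Walk a (p ++ q) d
  join stop       e v = step e v
  join (step f u) e v = step f (join u e v)

  Walk-reverse : ∀ {a b p} → Walk a p b → Walk b (reverse p) a
  Walk-reverse stop = stop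
  Walk-reverse (step {x} {p = p} e u) =
    subst (λ l → Walk _ l _) (sym (unfold-reverse x p)) (join (Walk-reverse u) (E-sym e) stop)

  Walk-split : ∀ {a b z q} p → Walk a (p ++ z ∷ q) b →
    Walk a (p ++ [ z ]) z × Walk z (z ∷ q) b
  Walk-split []          stop       = stop , stop
  Walk-split []          (step e u) = stop , step e u
  Walk-split (_ ∷ [])    (step e u) with Walk-split [] u
  ... | v , w = step e v , w
  Walk-split (_ ∷ c ∷ p) (step e u) with Walk-split (c ∷ p) u
  ... | v , w = step e v , w

  Walk-tail : ∀ {a b z q} → Walk a (a ∷ z ∷ q) b → E a z × Walk z (z ∷ q) b
  Walk-tail (step e stop)       = e , stop
  Walk-tail (step e (step f u)) = e , step f u

  -- Only the vertex set matters, hence the permutation: a rotation reorders the walk, and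
  -- prepending `w` changes an end.
  Extension : V → List V → Set
  Extension w p = ∃₂ λ a b → ∃[ p′ ] Walk a p′ b × p′ ↭ w ∷ p

  insert : ∀ {a b x y q w} p → Walk a (p ++ x ∷ y ∷ q) b → E w x → E w y →
    Extension w (p ++ x ∷ y ∷ q)
  insert {x = x} {y} {q} {w} p u ex ey with Walk-split p u
  ... | u₁ , u₂ = _ , _ , _ ,
    join u₁ (E-sym ex) (step ey (proj₂ (Walk-tail u₂))) ,
    ↭-trans (shift w (p ++ [ x ]) (y ∷ q)) (↭-reflexive (cong (w ∷_) (++-assoc p [ x ] (y ∷ q))))

  -- The walk `p x | y … z | d r` becomes `p x | z … y | w | d r`: the middle segment is reversed,
  -- with `w` between its old start `y` and `d`.
  rotate : ∀ {a b x y ys z d r w} p q → Walk a (p ++ x ∷ y ∷ ys) b → y ∷ ys ≡ q ++ z ∷ d ∷ r →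
    E x z → E w y → E w d → Extension w (p ++ x ∷ y ∷ ys)
  rotate {b = b} {x} {y} {ys} {z} {d} {r} {w} p q u eq ez ey ed
    with Walk-split p u
  ... | u₁ , u₂ with Walk-split q (subst (λ l → Walk y l b) eq (proj₂ (Walk-tail u₂)))
  ... | v₁ , v₂ = _ , _ , _ ,
    join u₁ ez (join (Walk-reverse v₁) (E-sym ey) (step ed (proj₂ (Walk-tail v₂)))) ,
    ↭-trans (++⁺ˡ (p ++ [ x ]) perm)
      (↭-trans (shift w (p ++ [ x ]) (y ∷ ys))
        (↭-reflexive (cong (w ∷_) (++-assoc p [ x ] (y ∷ ys)))))
    where
    perm : reverse (q ++ [ z ]) ++ w ∷ d ∷ r ↭ w ∷ y ∷ ys
    perm = ↭-trans (shift w (reverse (q ++ [ z ])) (d ∷ r))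
      (prep w (↭-trans (++⁺ʳ (d ∷ r) (↭-reverse (q ++ [ z ])))
        (↭-reflexive (trans (++-assoc q [ z ] (d ∷ r)) (sym eq)))))

  Precedes : V → List V → V → Set
  Precedes w xs z = ∃[ q ] ∃₂ λ d r → xs ≡ q ++ z ∷ d ∷ r × E w d

  Independent : List V → Set
  Independent = AllPairs λ x y → ¬ E x y

  -- Induction on the suffix `x ∷ ys` of the walk. When `y` is a neighbour of `w`, its predecessor
  -- `x` joins `c`: an edge from `w` to `x` would allow an insertion, and an edge from `x` to some
  -- `z` in `c` a rotation. The vertex `x` has no predecessor within the suffix, so only neighbours
  -- in `ys` are counted.
  predecessors : ∀ {a b P} w p x ys → Walk a P b → P ≡ p ++ x ∷ ys →
    Extension w P ⊎
    (∃[ c ] c ⊆ x ∷ ys × Independent (w ∷ c) × length c ≡ length (filter (E? w) ys) ×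
            All (Precedes w (x ∷ ys)) c)
  predecessors w p x []       u eq = inj₂ ([] , minimum _ , [] ∷ [] , refl , [])
  predecessors w p x (y ∷ ys) u eq
    with predecessors w (p ++ [ x ]) y ys u (trans eq (sym (++-assoc p [ x ] (y ∷ ys))))
  ... | inj₁ ext = inj₁ ext
  ... | inj₂ (c , s , (ic ∷ is) , l , prec) with E? w y
  ...   | no ¬ey = inj₂ (c , x ∷ʳ s , (ic ∷ is) , l ,
            All.map (λ { (q , d , r , e , ed) → x ∷ q , d , r , cong (x ∷_) e , ed }) prec)
  ...   | yes ey with E? w x
  ...     | yes ex = inj₁ (subst (Extension w) (sym eq) (insert p (subst (λ l → Walk _ l _) eq u) ex ey))
  ...     | no ¬ex with all-or c try
    where
    try : ∀ {z} → z ∈ c → Extension w _ ⊎ (¬ E x z)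
    try {z} i with E? x z | All.lookup prec i
    ... | no ¬ez | _ = inj₂ ¬ez
    ... | yes ez | q , d , r , e , ed =
      inj₁ (subst (Extension w) (sym eq) (rotate p q (subst (λ l → Walk _ l _) eq u) e ez ey ed))
  ...       | inj₁ ext = inj₁ ext
  ...       | inj₂ ix = inj₂ (x ∷ c , refl ∷ s , ((¬ex ∷ ic) ∷ ix ∷ is) , cong suc l ,
                ([] , y , ys , refl , ey) ∷
                All.map (λ { (q , d , r , e , ed) → x ∷ q , d , r , cong (x ∷_) e , ed }) prec)

  -- If `w` is adjacent to the first vertex, it is prepended. Otherwise every neighbour of `w` on
  -- the walk has a predecessor, and there are as many predecessors as neighbours.
  extend-or-independent : ∀ {a b p} w → Walk a p b →
    Extension w p ⊎
    (∃[ c ] c ⊆ p × Independent (w ∷ c) × length c ≡ length (filter (E? w) p))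
  extend-or-independent {a} w u with E? w a
  ... | yes e = inj₁ (_ , _ , _ , step e u , ↭-refl)
  extend-or-independent {a} w stop | no ¬e =
    inj₂ ([] , minimum _ , [] ∷ [] , cong length (sym (filter-reject (E? w) ¬e)))
  extend-or-independent {a} w u@(step {p = p} _ _) | no ¬e with predecessors w [] a p u refl
  ... | inj₁ ext = inj₁ ext
  ... | inj₂ (c , s , i , l , _) = inj₂ (c , s , i , trans l (cong length (sym (filter-reject (E? w) ¬e))))

  -- Long paths, or large bicliques and cliques in the complement.

  LongPath : ℕ → List V → Set
  LongPath n xs = ∃₂ λ a b → ∃₂ λ p q → Walk a p b × xs ↭ p ++ q × n ≤ length p

  Separated : List V → List V → Set
  Separated A B = ∀ a b → a ∈ A → b ∈ B → ¬ E a b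

  -- Uniqueness of `A ++ B` makes the two sides disjoint as well. Edges inside a side are
  -- unrestricted.
  CoBiclique : ℕ → ℕ → Set
  CoBiclique k l = ∃₂ λ A B → Unique (A ++ B) × Separated A B × k ≤ length A × l ≤ length B

  CoClique : ℕ → Set
  CoClique k = ∃[ C ] Unique C × Independent C × k ≤ length C

  discard-neighbours : ∀ {d} W p → (∀ {w} → w ∈ W → length (filter (E? w) p) ≤ d) →
    ∃[ q ] q ⊆ p × Separated W q × length p ≤ length q + length W * d
  discard-neighbours [] p deg = p , ⊆-refl , (λ _ _ ()) , m≤m+n _ _
  discard-neighbours {d} (w ∷ W) p deg with discard-neighbours W p (λ i → deg (there i))
  ... | q , s , sep , l = q′ , ⊆-trans (filter-⊆ _ q) s , sep′ , l′
    where
    q′ = filter (λ x → ¬? (E? w x)) q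
    sep′ : Separated (w ∷ W) q′
    sep′ _ _ (here refl) j = proj₂ (∈-filter⁻ (λ x → ¬? (E? w x)) {xs = q} j)
    sep′ _ _ (there i)   j = sep _ _ i (proj₁ (∈-filter⁻ (λ x → ¬? (E? w x)) j))
    l′ : length p ≤ length q′ + (d + length W * d)
    l′ = begin
      length p                                              ≤⟨ l ⟩
      length q + length W * d                               ≡⟨ cong (_+ length W * d) (length-filter-¬ (E? w) q) ⟩
      length q′ + length (filter (E? w) q) + length W * d   ≤⟨ +-monoˡ-≤ (length W * d) (+-monoʳ-≤ (length q′)
        (≤-trans (length-mono-≤ (filter⁺ (E? w) (E? w) (λ { refl e → e }) s)) (deg (here refl)))) ⟩
      length q′ + d + length W * d                          ≡⟨ +-assoc (length q′) d _ ⟩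
      length q′ + (d + length W * d)                        ∎
      where open ≤-Reasoning

  -- Depth-first search: P is the current branch with its tip first, S the
  -- finished vertices and U the unvisited ones.
  dfs : ∀ {k x y S P U xs} a b → length S + a ≡ k → length U ≡ b + k →
    Unique xs → xs ↭ S ++ P ++ U → Separated S U → Walk x P y →
    CoBiclique k (suc k) ⊎
    (∃₂ λ x y → ∃₂ λ p q → Walk x p y × xs ↭ p ++ q × length q ≤ k + k)
  -- `a` is what `S` lacks of `k` vertices, and `b` what `U` holds beyond `k`. With `b` at zero,
  -- `S ++ U` has at most `2k` vertices; with `a` at zero, `S` and `U` form the biclique.
  dfs {k} {S = S} {P} {U} a zero ∣S∣ ∣U∣ uniq perm sep u =
    inj₂ (_ , _ , P , S ++ U , u , ↭-trans perm (shifts S P) ,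
      ≤-trans (≤-reflexive (length-++ S))
        (+-mono-≤ (≤-trans (m≤m+n (length S) a) (≤-reflexive ∣S∣)) (≤-reflexive ∣U∣)))
  dfs {k} {S = S} {P} {U} zero (suc b) ∣S∣ ∣U∣ uniq perm sep u =
    inj₁ (S , U , AllPairs-resp-⊆ (Sub.++⁺ (⊆-refl {x = S}) (Sub.++⁺ˡ P (⊆-refl {x = U}))) (Unique-resp-↭ perm uniq) , sep ,
      ≤-reflexive (trans (sym ∣S∣) (+-identityʳ (length S))) ,
      ≤-trans (s≤s (m≤n+m k b)) (≤-reflexive (sym ∣U∣)))
  dfs {x = x} {S = S} {P} {U} (suc a) (suc b) ∣S∣ ∣U∣ uniq perm sep u with any? (E? x) U
  ... | yes some with find some
  ...   | z , z∈U , e with ∈⇒↭∷ z∈U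
  ...     | U′ , U↭ =
    dfs (suc a) b ∣S∣ (suc-injective (trans (sym (↭-length U↭)) ∣U∣)) uniq
      (↭-trans perm (++⁺ˡ S (↭-trans (++⁺ˡ P U↭) (shift z P U′))))
      (λ _ _ i j → sep _ _ i (∈-resp-↭ (↭-sym U↭) (there j)))
      (step (E-sym e) u)
  -- The tip `x` has no unvisited neighbour and becomes finished. If it was the root of its branch,
  -- the search restarts at an unvisited vertex.
  dfs {k} {x = x} {S = S} {U = U} (suc a) (suc b) ∣S∣ ∣U∣ uniq perm sep u | no none = backtrack U perm ∣U∣ u sep′
    where
    ∣S∣′ : suc (length S) + a ≡ k
    ∣S∣′ = trans (sym (+-suc (length S) a)) ∣S∣
    sep′ : Separated (x ∷ S) U
    sep′ _ _ (here refl) j e = none (lose j e)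
    sep′ _ _ (there i)   j   = sep _ _ i j
    backtrack : ∀ {P y} U → _ ↭ S ++ P ++ U → length U ≡ suc b + k → Walk x P y →
      Separated (x ∷ S) U → _
    backtrack (z ∷ U) perm ∣U∣ stop sep =
      dfs a b ∣S∣′ (suc-injective ∣U∣) uniq (↭-trans perm (shift x S (z ∷ U)))
        (λ _ _ i j → sep _ _ i (there j)) stop
    backtrack {P} U perm ∣U∣ (step {p = p} f u) sep =
      dfs a (suc b) ∣S∣′ ∣U∣ uniq (↭-trans perm (shift x S (p ++ U))) sep u

  -- The target is `suc n` vertices, so at least `k` vertices lie off `p`; `W` takes `k` of them.
  -- One with more than `d` neighbours on `p` either extends `p` or forms, with the predecessors, an
  -- independent set of at least `d + 2` vertices. If there is none, discarding all neighbours of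
  -- `W` costs at most `k * d` vertices of `p` and leaves `k + 1`.
  grow-step : ∀ {n k d a b p q} → suc n + k ≤ suc (length (p ++ q)) → k * d + suc k ≤ length p →
    Unique (p ++ q) → Walk a p b → length p ≤ n →
    (CoBiclique k (suc k) ⊎ CoClique (suc (suc d))) ⊎
    (∃₂ λ a b → ∃₂ λ p′ q′ → Walk a p′ b × p ++ q ↭ p′ ++ q′ × length p′ ≡ suc (length p))
  grow-step {n} {k} {d} {p = p} {q} big long uniq u ∣p∣≤n = result
    where
    W = take k q

    k≤∣q∣ : k ≤ length q
    k≤∣q∣ = +-cancelˡ-≤ (length p) k (length q) (begin
      length p + k          ≤⟨ +-monoˡ-≤ k ∣p∣≤n ⟩
      n + k                 ≤⟨ s≤s⁻¹ big ⟩
      length (p ++ q)       ≡⟨ length-++ p ⟩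
      length p + length q   ∎)
      where open ≤-Reasoning

    uniq′ : Unique (q ++ p)
    uniq′ = Unique-resp-↭ (++-comm p q) uniq

    classify : ∀ {w} → w ∈ W → (_ ⊎ _) ⊎ length (filter (E? w) p) ≤ d
    classify {w} w∈W with length (filter (E? w) p) ≤? d | extend-or-independent w u
    ... | yes few | _ = inj₂ few
    ... | no many | inj₂ (c , c⊆p , ind , l) =
      inj₁ (inj₁ (inj₂ (w ∷ c ,
        AllPairs-resp-⊆ (Sub.++⁺ (from∈ (Any-resp-⊆ (take-⊆ k q) w∈W)) c⊆p) uniq′ ,
        ind , s≤s (≤-trans (≰⇒> many) (≤-reflexive (sym l))))))
    ... | no many | inj₁ (a , b , p′ , v , p′↭) with ∈⇒↭∷ (Any-resp-⊆ (take-⊆ k q) w∈W)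
    ...   | q′ , q↭ = inj₁ (inj₂ (a , b , p′ , q′ , v ,
        ↭-trans (++⁺ˡ p q↭) (↭-trans (shift w p q′) (++⁺ʳ q′ (↭-sym p′↭))) ,
        ↭-length p′↭))

    result : _ ⊎ _
    result with all-or W classify
    ... | inj₁ r = r
    ... | inj₂ few with discard-neighbours W p (All.lookup few)
    ...   | B , B⊆p , sep , l = inj₁ (inj₁ (W , B ,
        AllPairs-resp-⊆ (Sub.++⁺ (take-⊆ k q) B⊆p) uniq′ , sep ,
        ≤-reflexive (sym ∣W∣) ,
        +-cancelˡ-≤ (k * d) _ _ (≤-trans long (≤-trans l (≤-reflexive
          (trans (cong (λ m → length B + m * d) ∣W∣) (+-comm (length B) (k * d))))))))
      where
      ∣W∣ : length W ≡ k
      ∣W∣ = length-take-≤ q k≤∣q∣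

  -- `f` bounds the number of missing vertices and drives the recursion. The bound with
  -- `suc (length xs)` expresses `n + k − 1` without truncated subtraction.
  grow : ∀ {n k d a b p q xs} f → n ≤ length p + f → n + k ≤ suc (length xs) →
    k * d + suc k ≤ length p → Unique xs → xs ↭ p ++ q → Walk a p b →
    (CoBiclique k (suc k) ⊎ CoClique (suc (suc d))) ⊎ LongPath n xs
  grow zero n≤ big long uniq perm u =
    inj₂ (_ , _ , _ , _ , u , perm , ≤-trans n≤ (≤-reflexive (+-identityʳ _)))
  grow {n} {p = p} (suc f) n≤ big long uniq perm u with n ≤? length p
  ... | yes done = inj₂ (_ , _ , _ , _ , u , perm , done)
  grow {zero} {p = p} (suc f) n≤ big long uniq perm u | no ¬done = contradiction z≤n ¬done
  grow {suc n} {k} {p = p} (suc f) n≤ big long uniq perm u | no ¬done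
    with grow-step (subst (λ l → suc n + k ≤ suc l) (↭-length perm) big) long
           (Unique-resp-↭ perm uniq) u (s≤s⁻¹ (≰⇒> ¬done))
  ... | inj₁ bad = inj₁ bad
  ... | inj₂ (_ , _ , p′ , q′ , v , perm′ , l) =
    grow f (≤-trans n≤ (≤-reflexive (trans (+-suc (length p) f) (cong (_+ f) (sym l))))) big
      (≤-trans long (≤-trans (n≤1+n _) (≤-reflexive (sym l)))) uniq (↭-trans perm perm′) v

  long-path : ∀ {n k d xs} → n + k ≤ suc (length xs) →
    k * d + suc k + (k + k) ≤ length xs → Unique xs →
    (CoBiclique k (suc k) ⊎ CoClique (suc (suc d))) ⊎ LongPath n xs
  long-path {k = k} {d} {[]} big long uniq =
    contradiction (≤-trans (m≤n+m (suc k) (k * d)) (≤-trans (m≤m+n _ (k + k)) long)) λ ()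
  long-path {n} {k} {d} {x ∷ xs} big long uniq
    with dfs {S = []} {U = xs} k (length xs ∸ k) refl
           (sym (m∸n+n≡m (s≤s⁻¹ (≤-trans (m≤n+m (suc k) (k * d)) (≤-trans (m≤m+n _ (k + k)) long))))) uniq ↭-refl (λ _ _ ()) stop
  ... | inj₁ bic = inj₁ (inj₁ bic)
  ... | inj₂ (_ , _ , p , q , u , perm , ∣q∣) =
    grow n (m≤n+m n (length p)) big
      -- The search path misses at most `2k` vertices, which the summand `k + k` in `long` pays for.
      (+-cancelʳ-≤ (k + k) _ _ (begin
        k * d + suc k + (k + k)   ≤⟨ long ⟩
        length (x ∷ xs)           ≡⟨ ↭-length perm ⟩
        length (p ++ q)           ≡⟨ length-++ p ⟩
        length p + length q       ≤⟨ +-monoʳ-≤ (length p) ∣q∣ ⟩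
        length p + (k + k)        ∎)) uniq perm u
    where open ≤-Reasoning

  -- Packing disjoint paths.

  Walk-take : ∀ {a b p} n → Walk a p b → ∃[ c ] Walk a (take (suc n) p) c
  Walk-take zero    stop       = _ , stop
  Walk-take zero    (step e u) = _ , stop
  Walk-take (suc n) stop       = _ , stop
  Walk-take (suc n) (step e u) with Walk-take n u
  ... | c , v = c , step e v

  Walk-lookup : ∀ {a b p} → Walk a p b → ∀ i j → toℕ j ≡ suc (toℕ i) → E (lookup p i) (lookup p j)
  Walk-lookup stop                zero    zero          ()
  Walk-lookup (step e stop)       zero    (suc zero)    eq = e
  Walk-lookup (step e (step _ _)) zero    (suc zero)    eq = e
  Walk-lookup (step e u)          (suc i) (suc j)       eq = Walk-lookup u i j (suc-injective eq)

  -- Vertices are indexed by copy and position, as `remQuot` splits them in `copies`. `available`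
  -- keeps the packing disjoint from a path whose vertices were removed from the pool.
  record Packing (t n : ℕ) (xs : List V) : Set where
    field
      vertex      : Fin t → Fin n → V
      available   : ∀ i x → vertex i x ∈ xs
      distinct    : ∀ i j x y → vertex i x ≡ vertex j y → i ≡ j × x ≡ y
      consecutive : ∀ i x y → toℕ y ≡ suc (toℕ x) → E (vertex i x) (vertex i y)
  open Packing public

  Packing-∷ : ∀ {t n a b p r xs} → Walk a p b → length p ≡ n → Unique xs → xs ↭ p ++ r →
    Packing t n r → Packing (suc t) n xs
  Packing-∷ {t} {n} {p = p} {r} {xs} u refl uniq perm P = record
    { vertex = v ; available = av ; distinct = di ; consecutive = co }
    where
    uniq′ : Unique (p ++ r)
    uniq′ = Unique-resp-↭ perm uniq

    v : Fin (suc t) → Fin (length p) → V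
    v zero    x = lookup p x
    v (suc i) x = vertex P i x

    av : ∀ i x → v i x ∈ xs
    av zero    x = ∈-resp-↭ (↭-sym perm) (∈-++⁺ˡ (∈-lookup {xs = p} x))
    av (suc i) x = ∈-resp-↭ (↭-sym perm) (∈-++⁺ʳ p (available P i x))

    di : ∀ i j x y → v i x ≡ v j y → i ≡ j × x ≡ y
    di zero    zero    x y eq = refl , lookup-injective (AllPairs-resp-⊆ (Sub.++⁺ʳ r (⊆-refl {x = p})) uniq′) x y eq
    di zero    (suc j) x y eq = contradiction eq (Unique-++⇒≢ p uniq′ (∈-lookup x) (available P j y))
    di (suc i) zero    x y eq = contradiction (sym eq) (Unique-++⇒≢ p uniq′ (∈-lookup y) (available P i x))
    di (suc i) (suc j) x y eq with distinct P i j x y eq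
    ... | refl , x≡y = refl , x≡y

    co : ∀ i x y → toℕ y ≡ suc (toℕ x) → E (v i x) (v i y)
    co zero    x y eq = Walk-lookup u x y eq
    co (suc i) x y eq = consecutive P i x y eq

  -- Induction on `t`. While a copy is still to be found, `xs` has at least `suc n + k − 1`
  -- vertices, and `large` turns this into the size that `long-path` requires.
  pack : ∀ {n k d} t {xs} → k * d + suc k + (k + k) < suc n + k → t * suc n + k ≤ suc (length xs) →
    Unique xs → (CoBiclique k (suc k) ⊎ CoClique (suc (suc d))) ⊎ Packing t (suc n) xs
  pack zero _ _ _ = inj₂ (record { vertex = λ () ; available = λ () ; distinct = λ () ; consecutive = λ () })
  pack {n} {k} (suc t) {xs} large big uniq
    with long-path {suc n} {k} enough (s≤s⁻¹ (≤-trans large enough)) uniq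
    where
    enough : suc n + k ≤ suc (length xs)
    enough = ≤-trans (+-monoˡ-≤ k (m≤m+n (suc n) (t * suc n))) big
  ... | inj₁ bad = inj₁ bad
  ... | inj₂ (_ , _ , p , q , u , perm , n≤∣p∣) with pack t large big′ uniq′
    where
    -- Vertices of the path beyond the first `suc n` return to the pool, so exactly `suc n` are
    -- spent.
    r = drop (suc n) p ++ q

    perm′ : xs ↭ take (suc n) p ++ r
    perm′ = ↭-trans perm (↭-reflexive (take-drop-++ (suc n) p))

    uniq′ : Unique r
    uniq′ = AllPairs-resp-⊆ (Sub.++⁺ˡ (take (suc n) p) ⊆-refl) (Unique-resp-↭ perm′ uniq)

    big′ : t * suc n + k ≤ suc (length r)
    big′ = +-cancelˡ-≤ (suc n) _ _ (begin
      suc n + (t * suc n + k)                  ≡⟨ +-assoc (suc n) (t * suc n) k ⟨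
      suc n + t * suc n + k                    ≤⟨ big ⟩
      suc (length xs)                          ≡⟨ cong suc (↭-length perm′) ⟩
      suc (length (take (suc n) p ++ r))       ≡⟨ cong suc (length-++ (take (suc n) p)) ⟩
      suc (length (take (suc n) p) + length r) ≡⟨ cong (λ l → suc (l + length r)) (length-take-≤ p n≤∣p∣) ⟩
      suc (suc n + length r)                   ≡⟨ +-suc (suc n) (length r) ⟨
      suc n + suc (length r)                   ∎)
      where open ≤-Reasoning
  ...   | inj₁ bad = inj₁ bad
  ...   | inj₂ P = inj₂ (Packing-∷ (proj₂ (Walk-take n u)) (length-take-≤ p n≤∣p∣) uniq
            (↭-trans perm (↭-reflexive (take-drop-++ (suc n) p))) P)

-- Halving, parity and the bipartition of the Jahangir graph.

⌊n*2/2⌋≡n : ∀ n → ⌊ n * 2 /2⌋ ≡ n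
⌊n*2/2⌋≡n zero    = refl
⌊n*2/2⌋≡n (suc n) = cong suc (⌊n*2/2⌋≡n n)

⌊1+n*2/2⌋≡n : ∀ n → ⌊ suc (n * 2) /2⌋ ≡ n
⌊1+n*2/2⌋≡n zero    = refl
⌊1+n*2/2⌋≡n (suc n) = cong suc (⌊1+n*2/2⌋≡n n)

⌊n/2⌋< : ∀ {n k} → n < k * 2 → ⌊ n /2⌋ < k
⌊n/2⌋< {zero}        {suc k} _               = s≤s z≤n
⌊n/2⌋< {suc zero}    {suc k} _               = s≤s z≤n
⌊n/2⌋< {suc (suc n)} {suc k} (s≤s (s≤s n<)) = s≤s (⌊n/2⌋< n<)

parity-⌊/2⌋-injective : ∀ m n → parity m ≡ parity n → ⌊ m /2⌋ ≡ ⌊ n /2⌋ → m ≡ n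
parity-⌊/2⌋-injective zero          zero          _ _ = refl
parity-⌊/2⌋-injective zero          (suc zero)    () _
parity-⌊/2⌋-injective zero          (suc (suc n)) _ ()
parity-⌊/2⌋-injective (suc zero)    (suc zero)    _ _ = refl
parity-⌊/2⌋-injective (suc (suc m)) (suc (suc n)) p h =
  cong (λ l → suc (suc l)) (parity-⌊/2⌋-injective m n p (suc-injective h))

parity-suc : ∀ n → parity (suc n) ≡ parity n ⁻¹
parity-suc n = trans (sym (ℙ.⁻¹-involutive (parity (suc n)))) (cong _⁻¹ (ℙ.suc-homo-⁻¹ n))

parity-*ʳ : ∀ m {n} → parity n ≡ 0ℙ → parity (m * n) ≡ 0ℙ
parity-*ʳ m {n} even = trans (ℙ.*-homo-* m n) (trans (cong (parity m *ℙ_) even) (ℙ.*-zeroʳ (parity m)))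

-- For even s the Jahangir graph is bipartite: the classes are the k cycle
-- vertices at even positions (zero-based), and the hub with the other k.
module Bipartition {s m k : ℕ} (sm≡k2 : s * m ≡ k * 2) (s-even : parity s ≡ 0ℙ) where

  position : Fin (s * m) → Fin k
  position i = fromℕ< (⌊n/2⌋< (≤-trans (Fin.toℕ<n i) (≤-reflexive sm≡k2)))

  -- Odd positions are shifted by `suc` because index `zero` of the larger class is reserved for the
  -- hub.
  toSide : Parity → Fin k → Fin k ⊎ Fin (suc k)
  toSide 0ℙ x = inj₁ x
  toSide 1ℙ x = inj₂ (suc x)

  side : Fin (suc (s * m)) → Fin k ⊎ Fin (suc k)
  side zero    = inj₂ zero
  side (suc i) = toSide (parity (toℕ i)) (position i)

  colour : Fin k ⊎ Fin (suc k) → Parity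
  colour (inj₁ _) = 0ℙ
  colour (inj₂ _) = 1ℙ

  colour-toSide : ∀ p x → colour (toSide p x) ≡ p
  colour-toSide 0ℙ _ = refl
  colour-toSide 1ℙ _ = refl

  toSide-injective : ∀ p q x y → toSide p x ≡ toSide q y → p ≡ q × x ≡ y
  toSide-injective 0ℙ 0ℙ _ _ refl = refl , refl
  toSide-injective 1ℙ 1ℙ _ _ refl = refl , refl

  toSide≢hub : ∀ p x → toSide p x ≢ inj₂ zero
  toSide≢hub 0ℙ _ ()
  toSide≢hub 1ℙ _ ()

  side-injective : ∀ x y → side x ≡ side y → x ≡ y
  side-injective zero    zero    _  = refl
  side-injective zero    (suc j) eq = contradiction (sym eq) (toSide≢hub _ _)
  side-injective (suc i) zero    eq = contradiction eq (toSide≢hub _ _)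
  side-injective (suc i) (suc j) eq with toSide-injective _ _ _ _ eq
  ... | p , h = cong suc (Fin.toℕ-injective (parity-⌊/2⌋-injective (toℕ i) (toℕ j) p
                  (Fin.fromℕ<-injective _ _ _ _ h)))

  colour-suc : ∀ i → colour (side (suc i)) ≡ parity (toℕ i)
  colour-suc i = colour-toSide (parity (toℕ i)) (position i)

  -- Neighbours of the hub sit at multiples of the even number `s`, hence at even positions.
  -- Consecutive positions differ in parity, also across the closing edge, since `sm` is even.
  JahangirRel⇒≢ : ∀ x y → JahangirRel s m x y → colour (side x) ≢ colour (side y)
  JahangirRel⇒≢ zero (suc i) (q , eq) same = contradiction
    (trans same (trans (colour-suc i) (trans (cong parity eq) (parity-*ʳ (toℕ q) s-even)))) λ ()
  JahangirRel⇒≢ (suc i) (suc j) next same = ℙ.p≢p⁻¹ (parity (toℕ i))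
    (trans (trans (sym (colour-suc i)) (trans same (colour-suc j))) (flips next))
    where
    flips : CyclicSuc i j → parity (toℕ j) ≡ parity (toℕ i) ⁻¹
    flips (inj₁ eq)          = trans (cong parity eq) (parity-suc (toℕ i))
    flips (inj₂ (last , eq)) = trans (cong parity eq)
      (trans (sym (trans (cong parity (trans last sm≡k2)) (parity-*ʳ k refl))) (parity-suc (toℕ i)))

  Adj⇒≢ : ∀ {x y} → Adj (jahangir s m) x y → colour (side x) ≢ colour (side y)
  Adj⇒≢ (_ , inj₁ r) = JahangirRel⇒≢ _ _ r
  Adj⇒≢ (_ , inj₂ r) = ≢-sym (JahangirRel⇒≢ _ _ r)

-- From lists of vertices to subgraph embeddings.

module _ {N : ℕ} (F : Graph N) where
  open Paths (Adj F) (symm F) (adj? F)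

  CoClique⇒Contains : ∀ {n} (G : Graph n) → CoClique n → Contains (complement F) G
  CoClique⇒Contains G (C , uniq , ind , n≤) = f , inj , adj
    where
    f : _ → Fin N
    f i = lookup C (inject≤ i n≤)
    inj : Injective _≡_ _≡_ f
    inj {i} {j} eq = Fin.inject≤-injective n≤ n≤ i j (lookup-injective uniq _ _ eq)
    adj : ∀ {i j} → Adj G i j → Adj (complement F) (f i) (f j)
    adj {i} {j} a = AllPairs-lookup (symm (complement F)) (zip (uniq , ind)) _ _
      λ eq → irrefl G (Fin.inject≤-injective n≤ n≤ i j eq) a

  CoBiclique⇒Contains : ∀ {s m k} → s * m ≡ k * 2 → parity s ≡ 0ℙ →
    CoBiclique k (suc k) → Contains (complement F) (jahangir s m)
  CoBiclique⇒Contains {s} {m} {k} sm≡k2 s-even (A , B , uniq , sep , k≤A , k<B) =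
    (λ x → f (side x)) , (λ eq → side-injective _ _ (inj _ _ eq)) , λ a → adj _ _ (Adj⇒≢ a)
    where
    open Bipartition {s} {m} {k} sm≡k2 s-even

    f : Fin k ⊎ Fin (suc k) → Fin N
    f (inj₁ x) = lookup A (inject≤ x k≤A)
    f (inj₂ x) = lookup B (inject≤ x k<B)

    disjoint : ∀ x y → f (inj₁ x) ≢ f (inj₂ y)
    disjoint x y = Unique-++⇒≢ A uniq (∈-lookup _) (∈-lookup _)

    cross : ∀ x y → Adj (complement F) (f (inj₁ x)) (f (inj₂ y))
    cross x y = disjoint x y , sep _ _ (∈-lookup _) (∈-lookup _)

    inj : ∀ u v → f u ≡ f v → u ≡ v
    inj (inj₁ x) (inj₁ y) eq = cong inj₁ (Fin.inject≤-injective k≤A k≤A x y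
      (lookup-injective (AllPairs-resp-⊆ (Sub.++⁺ʳ B (⊆-refl {x = A})) uniq) _ _ eq))
    inj (inj₁ x) (inj₂ y) eq = contradiction eq (disjoint x y)
    inj (inj₂ x) (inj₁ y) eq = contradiction (sym eq) (disjoint y x)
    inj (inj₂ x) (inj₂ y) eq = cong inj₂ (Fin.inject≤-injective k<B k<B x y
      (lookup-injective (AllPairs-resp-⊆ (Sub.++⁺ˡ A (⊆-refl {x = B})) uniq) _ _ eq))

    adj : ∀ u v → colour u ≢ colour v → Adj (complement F) (f u) (f v)
    adj (inj₁ _) (inj₁ _) c = contradiction refl c
    adj (inj₁ x) (inj₂ y) c = cross x y
    adj (inj₂ x) (inj₁ y) c = symm (complement F) (cross y x)
    adj (inj₂ _) (inj₂ _) c = contradiction refl c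

  Packing⇒Contains : ∀ {n t} {xs : List (Fin N)} → Packing t n xs → Contains F (copies t (path n))
  Packing⇒Contains {n} {t} P = f , inj , adj
    where
    f : Fin (t * n) → Fin N
    f x = vertex P (proj₁ (remQuot {t} n x)) (proj₂ (remQuot {t} n x))
    inj : Injective _≡_ _≡_ f
    inj {x} {y} eq with distinct P _ _ _ _ eq
    ... | c , p = trans (sym (Fin.combine-remQuot {t} n x))
                    (trans (cong₂ combine c p) (Fin.combine-remQuot {t} n y))
    adj : ∀ {x y} → Adj (copies t (path n)) x y → Adj F (f x) (f y)
    adj {x} {y} (c , _ , inj₁ next) =
      subst (λ i → Adj F (f x) (vertex P i _)) c (consecutive P _ _ _ next)
    adj {x} {y} (c , _ , inj₂ next) =
      subst (λ i → Adj F (f x) (vertex P i _)) c (symm F (consecutive P _ _ _ next))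

-- Lower bound.

path-neighbour : ∀ {n} (x : Fin (suc (suc n))) → ∃[ y ] Adj (path (suc (suc n))) x y
path-neighbour zero    = suc zero , (λ ()) , inj₁ refl
path-neighbour (suc x) = inject₁ x ,
  (λ eq → 1+n≢n (trans (cong toℕ eq) (Fin.toℕ-inject₁ x))) ,
  inj₂ (cong suc (sym (Fin.toℕ-inject₁ x)))

copies-neighbour : ∀ {n} t {G : Graph n} → (∀ x → ∃[ y ] Adj G x y) →
  ∀ x → ∃[ y ] Adj (copies t G) x y
copies-neighbour {n} t {G} nb x with nb (proj₂ (remQuot {t} n x))
... | y , a = combine (proj₁ (remQuot {t} n x)) y ,
  sym (cong proj₁ rc) , subst (Adj G _) (sym (cong proj₂ rc)) a
  where
  rc : remQuot {t} n (combine (proj₁ (remQuot {t} n x)) y) ≡ (proj₁ (remQuot {t} n x) , y)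
  rc = Fin.remQuot-combine (proj₁ (remQuot {t} n x)) y

cliqueBelow : (M c : ℕ) → Graph M
cliqueBelow M c .Adj i j = i ≢ j × toℕ i < c × toℕ j < c
cliqueBelow M c .symm (i≢j , i< , j<) = ≢-sym i≢j , j< , i<
cliqueBelow M c .irrefl i≡j (i≢j , _) = i≢j i≡j
cliqueBelow M c .adj? i j = ¬? (i Fin.≟ j) ×-dec (toℕ i <? c) ×-dec (toℕ j <? c)

-- A vertex with a neighbour cannot be sent to an isolated vertex, so all of `G` is mapped into the
-- clique.
cliqueBelow-contains⇒≤ : ∀ {M c n} (G : Graph n) → (∀ x → ∃[ y ] Adj G x y) →
  Contains (cliqueBelow M c) G → n ≤ c
cliqueBelow-contains⇒≤ {M} {c} {n} G nb (f , inj , adj) = Fin.injective⇒≤ {f = g} g-inj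
  where
  below : ∀ x → toℕ (f x) < c
  below x = proj₁ (proj₂ (adj (proj₂ (nb x))))
  g : Fin n → Fin c
  g x = fromℕ< (below x)
  g-inj : Injective _≡_ _≡_ g
  g-inj eq = inj (Fin.toℕ-injective (Fin.fromℕ<-injective _ _ _ _ eq))

-- The edges v₁v₂, v₃v₄, … form a matching of size k, and every edge outside
-- the clique has an end among the M − c isolated vertices.
cliqueBelow-complement⇒≤ : ∀ {M c s m k} → s * m ≡ k * 2 →
  Contains (complement (cliqueBelow M c)) (jahangir s m) → k ≤ M ∸ c
cliqueBelow-complement⇒≤ {M} {c} {s} {m} {k} sm≡k2 (f , inj , adj) = Fin.injective⇒≤ {f = g} g-inj
  where
  -- `index` recovers from a cycle vertex the number of its matching edge, so different edges have
  -- different chosen endpoints.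
  index : Fin (suc (s * m)) → ℕ
  index zero    = 0
  index (suc i) = ⌊ toℕ i /2⌋

  1+j*2<sm : (j : Fin k) → suc (toℕ j * 2) < s * m
  1+j*2<sm j = ≤-trans (*-monoˡ-≤ 2 (Fin.toℕ<n j)) (≤-reflexive (sym sm≡k2))

  j*2<sm : (j : Fin k) → toℕ j * 2 < s * m
  j*2<sm j = ≤-trans (n≤1+n _) (1+j*2<sm j)

  endpoint : (j : Fin k) → ∃[ v ] index v ≡ toℕ j × c ≤ toℕ (f v)
  endpoint j with toℕ (f (suc (fromℕ< (j*2<sm j)))) <? c | toℕ (f (suc (fromℕ< (1+j*2<sm j)))) <? c
  ... | no ≥c | _ = _ , trans (cong ⌊_/2⌋ (Fin.toℕ-fromℕ< _)) (⌊n*2/2⌋≡n (toℕ j)) , ≮⇒≥ ≥c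
  ... | yes _ | no ≥c = _ , trans (cong ⌊_/2⌋ (Fin.toℕ-fromℕ< _)) (⌊1+n*2/2⌋≡n (toℕ j)) , ≮⇒≥ ≥c
  ... | yes u<c | yes v<c = contradiction (fu≢fv , u<c , v<c) (proj₂ e)
    where
    next : _ ≡ suc _
    next = trans (Fin.toℕ-fromℕ< (1+j*2<sm j)) (cong suc (sym (Fin.toℕ-fromℕ< _)))
    e : Adj (complement (cliqueBelow M c)) _ _
    e = adj ((λ eq → 1+n≢n (trans (sym next) (cong toℕ (sym (Fin.suc-injective eq))))) , inj₁ (inj₁ next))
    fu≢fv = proj₁ e

  g : Fin k → Fin (M ∸ c)
  g j = fromℕ< (∸-monoˡ-< (Fin.toℕ<n (f (proj₁ (endpoint j)))) (proj₂ (proj₂ (endpoint j))))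

  g-inj : Injective _≡_ _≡_ g
  g-inj {i} {j} eq = Fin.toℕ-injective (begin
    toℕ i                        ≡⟨ proj₁ (proj₂ (endpoint i)) ⟨
    index (proj₁ (endpoint i))   ≡⟨ cong index (inj (Fin.toℕ-injective
      (∸-cancelʳ-≡ (proj₂ (proj₂ (endpoint i))) (proj₂ (proj₂ (endpoint j)))
        (Fin.fromℕ<-injective _ _ _ _ eq)))) ⟩
    index (proj₁ (endpoint j))   ≡⟨ proj₁ (proj₂ (endpoint j)) ⟩
    toℕ j                        ∎)
    where open ≡-Reasoning

lower-bound : ∀ {s m k t n} → s * m ≡ k * 2 → 2 ≤ n → 1 ≤ t → 1 ≤ k →
  ∀ M → Arrows M (copies t (path n)) (jahangir s m) → t * n + k ∸ 1 ≤ M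
lower-bound {s} {m} {suc k} {suc t} {suc (suc n)} sm≡k2 (s≤s (s≤s z≤n)) 1≤t 1≤k M arrows
  with arrows (cliqueBelow M (suc n + t * suc (suc n)))
... | inj₁ F⊇P = contradiction
  (cliqueBelow-contains⇒≤ (copies (suc t) (path (suc (suc n)))) (copies-neighbour (suc t) {path (suc (suc n))} path-neighbour) F⊇P)
  (<⇒≱ (n<1+n _))
... | inj₂ F̄⊇J = begin
  -- Here `c` is `tn − 1` in the original parameters, so the goal computes to this sum.
  c + suc k         ≤⟨ +-monoʳ-≤ c 1+k≤M∸c ⟩
  c + (M ∸ c)       ≡⟨ m+[n∸m]≡n (<⇒≤ c<M) ⟩
  M                 ∎
  where
  open ≤-Reasoning
  c = suc n + t * suc (suc n)
  1+k≤M∸c : suc k ≤ M ∸ c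
  1+k≤M∸c = cliqueBelow-complement⇒≤ sm≡k2 F̄⊇J
  -- Subtraction is truncated, so `c < M` has to be read off from `M ∸ c` being positive.
  c<M : c < M
  c<M = m∸n≢0⇒n<m {M} {c} λ eq → contradiction (subst (suc k ≤_) eq 1+k≤M∸c) λ ()

-- Arithmetic of the bound on `n`, upper bound and conclusion.

threshold : ∀ {k n sm} → sm ≡ k * 2 → 3 ≤ k → n ≥ (k ∸ 1) * (2 * sm ∸ 1) + 1 →
  k * (k * 2 ∸ 1) + suc k + (k + k) < n + k
threshold {suc (suc (suc j))} {n} refl (s≤s (s≤s (s≤s z≤n))) n≥ = begin
  -- With `k = 3 + j`, the slack at the least admissible `n` is `2k(k − 3) = 2j² + 6j`, with
  -- equality at `k = 3`.
  suc ((3 + j) * (5 + j * 2) + (4 + j) + ((3 + j) + (3 + j)))           ≤⟨ m≤m+n _ (2 * j * j + 6 * j) ⟩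
  suc ((3 + j) * (5 + j * 2) + (4 + j) + ((3 + j) + (3 + j))) + (2 * j * j + 6 * j) ≡⟨ identity j ⟩
  (2 + j) * (11 + 4 * j) + 1 + (3 + j)                                  ≡⟨ cong (λ d → (2 + j) * d + 1 + (3 + j)) (degree j) ⟨
  (2 + j) * (2 * ((3 + j) * 2) ∸ 1) + 1 + (3 + j)                       ≤⟨ +-monoˡ-≤ (3 + j) n≥ ⟩
  n + (3 + j)                                                           ∎
  where
  open ≤-Reasoning
  identity : ∀ j → suc ((3 + j) * (5 + j * 2) + (4 + j) + ((3 + j) + (3 + j))) + (2 * j * j + 6 * j) ≡
    (2 + j) * (11 + 4 * j) + 1 + (3 + j)
  identity = solve-∀
  double : ∀ j → 2 * ((3 + j) * 2) ≡ 12 + 4 * j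
  double = solve-∀
  degree : ∀ j → 2 * ((3 + j) * 2) ∸ 1 ≡ 11 + 4 * j
  degree j = cong (_∸ 1) (double j)

upper-bound : ∀ {s m k t n} → s * m ≡ k * 2 → parity s ≡ 0ℙ → 1 ≤ k → 1 ≤ n →
  k * (k * 2 ∸ 1) + suc k + (k + k) < n + k →
  Arrows (t * n + k ∸ 1) (copies t (path n)) (jahangir s m)
upper-bound {s} {m} {suc k} {t} {suc n} sm≡k2 s-even 1≤k 1≤n large F
  -- `large` fixes `d` as `sm − 1`, so a co-clique has `d + 2 = sm + 1` vertices, as many as the
  -- Jahangir graph.
  with Paths.pack (Adj F) (symm F) (adj? F) {n} {suc k} t large
         (≤-trans (m≤n+m∸n _ 1) (s≤s (≤-reflexive (sym (length-tabulate (λ i → i)))))) (allFin⁺ _)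
... | inj₁ (inj₁ bic) = inj₂ (CoBiclique⇒Contains F sm≡k2 s-even bic)
... | inj₁ (inj₂ (C , uniq , ind , l)) = inj₂ (CoClique⇒Contains F (jahangir s m)
        (C , uniq , ind , ≤-trans (≤-reflexive (cong suc sm≡k2)) l))
... | inj₂ P = inj₁ (Packing⇒Contains F P)

theorem3 : (s m t n : ℕ) → s ≥ 2 → 2 ∣ s → m ≥ 3 → t ≥ 1 →
    n ≥ (((s * m) / 2) ∸ 1) * ((2 * (s * m)) ∸ 1) + 1 →
    IsRamseyNumber (copies t (path n)) (jahangir s m) ((t * n + ((s * m) / 2)) ∸ 1)
theorem3 s m t n s≥2 (divides q refl) m≥3 t≥1 n≥ =
  upper-bound {k = k} sm≡k2 (parity-*ʳ q refl) (≤-trans (s≤s z≤n) k≥3) (≤-trans (s≤s z≤n) n≥2)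
    (threshold sm≡k2 k≥3 n≥) ,
  lower-bound {k = k} sm≡k2 n≥2 t≥1 (≤-trans (s≤s z≤n) k≥3)
  where
  k = (s * m) / 2

  sm≡qm2 : q * 2 * m ≡ q * m * 2
  sm≡qm2 = trans (*-assoc q 2 m) (trans (cong (q *_) (*-comm 2 m)) (sym (*-assoc q m 2)))

  k≡qm : k ≡ q * m
  k≡qm = trans (cong (_/ 2) sm≡qm2) (m*n/n≡m (q * m) 2)

  sm≡k2 : s * m ≡ k * 2
  sm≡k2 = trans sm≡qm2 (cong (_* 2) (sym k≡qm))

  k≥3 : 3 ≤ k
  k≥3 = ≤-trans (*-mono-≤ (*-cancelʳ-≤ 1 q 2 s≥2) m≥3) (≤-reflexive (sym k≡qm))

  -- Ensures that the path has no isolated vertex, as the lower bound requires.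
  n≥2 : 2 ≤ n
  n≥2 = +-cancelʳ-≤ k 2 n (begin
    2 + k                                             ≤⟨ s≤s (m≤n+m (suc k) (k * (k * 2 ∸ 1))) ⟩
    suc (k * (k * 2 ∸ 1) + suc k)                     ≤⟨ s≤s (m≤m+n _ (k + k)) ⟩
    suc (k * (k * 2 ∸ 1) + suc k + (k + k))           ≤⟨ threshold sm≡k2 k≥3 n≥ ⟩
    n + k                                             ∎)
    where open ≤-Reasoning
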